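{- Let $G$ and $H$ be graphs with $V(G)=[g]$ and $V(H)=[h]$. Then: (i) $\iota_L\,\mathrm{Hom}_+^t(G,H)=\iota_L\,\mathrm{Hom}_+(G,H)=\mathrm{Hom}(G,H)\times\tfrac{\mathbf 1}{g}$. In particular, all these complexes are canonically embedded in the same Euclidean space $\mathbb R^{gh}\times\mathbb R^g$. (ii) Sending each face $\sigma$ of $\mathrm{Hom}_+(G,H)$ through the maps $$\mathrm{Hom}_+(G,H)\xrightarrow{\ \iota_L\ }\mathrm{Hom}(G,H)\times\tfrac{\mathbf 1}{g}\xrightarrow{\ \pi_\Box\ }\pi_\Box\big(\mathrm{Hom}(G,H)\times\tfrac{\mathbf 1}{g}\big)$$ gives the same result as sending it through $$\mathrm{Hom}_+(G,H)\xrightarrow{\ \pi_\Box\ }\pi_\Box\mathrm{Hom}_+(G,H)\xrightarrow{\ \iota_{\pi_\Box(L)}\ }\pi_\Box\big(\mathrm{Hom}(G,H)\times\tfrac{\mathbf 1}{g}\big),$$ that is, the square formed by these four maps is well defined and commutes; moreover $\mathrm{Hom}_+(G,H)\subset \star_{x\in V(G)}\Delta_{V(H)}$, $\mathrm{Hom}(G,H)\times\frac{\mathbf 1}{g}\subset\Delta_{V(G)\times V(H)}\times\frac{\mathbf 1}{g}$, $\pi_\Box\mathrm{Hom}_+(G,H)\subset\Delta_{V(H)}\times\Delta_{V(G)}$ and $\pi_\Box(\mathrm{Hom}(G,H)\times\frac{\mathbf 1}{g})\subset\Delta_{V(H)}\times\frac{\mathbf 1}{g}$. In particular, the image $\pi_\Box(\sigma)$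 of any face $\sigma$ of $\mathrm{Hom}_+(G,H)$ is the convex hull of some vertices of $\Delta_{V(H)}\times\Delta_{V(G)}$, and $$\pi_\Box\big(\mathrm{Hom}(G,H)\times\tfrac{\mathbf 1}{g}\big)=\iota_{\pi_\Box(L)}\,\pi_\Box\mathrm{Hom}_+(G,H).$$ (iii) The statements in (ii) also hold with $\mathrm{Hom}_+(G,H)$ replaced by $\mathrm{Hom}_+^t(G,H)$.
   Context: Graphs are finite and undirected. For a finite set $B$, $\Delta_B=\mathrm{conv}\{e_i:i\in B\}\subset\mathbb R^{|B|}$; a subset of $B$ is identified with the face of $\Delta_B$ it spans (the empty set being the empty face). For $1\le i\le g$, $\mu_i:\mathbb R^h\hookrightarrow\mathbb R^{gh}=\mathbb R^h\times\dots\times\mathbb R^h$ is the inclusion as the $i$-th block. The join $\star_{x\in V(G)}\Delta_{V(H)}$ of $g$ labelled copies of $\Delta_{V(H)}$ is realized as the $(gh-1)$-simplex $\mathrm{conv}\bigcup_{i=1}^g\mu_i(\Delta_{V(H)})\times e_i\subset\mathbb R^{gh}\times\mathbb R^g$; its faces are $\star_{i}\sigma_i=\mathrm{conv}\bigcup_{i=1}^g\mu_i(\sigma_i)\times e_i$ with $\sigma_i\subset V(H)$ (possibly empty). $\mathrm{Hom}(G,H)$ is the polytopal complex of all cells $\times_{x\in V(G)}\sigma_x$ (all $\sigma_x\subset V(H)$ nonempty) of $\times_{x\in V(G)}\Delta_{V(H)}$ such that if $(x,y)\in E(G)$ then $(\sigma_x,\sigma_y)$ is a complete bipartite subgraph of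 $H$, i.e. every pair $(u,v)\in\sigma_x\times\sigma_y$ is an edge of $H$ (not required to be induced). It is realized in $\mathbb R^{gh}$ with the cell $\times_x\sigma_x$ realized as $\frac1g\big(\mu_1(\sigma_1)\times\dots\times\mu_g(\sigma_g)\big)=\frac1g\sum_i\mu_i(\sigma_i)$. $\mathrm{Hom}_+(G,H)$ is the simplicial subcomplex of $\star_{x\in V(G)}\Delta_{V(H)}$ of all simplices $\star_x\sigma_x$ such that if $(x,y)\in E(G)$ and both $\sigma_x,\sigma_y$ are nonempty, then $(\sigma_x,\sigma_y)$ is a complete bipartite subgraph of $H$. A face $\star_x\sigma_x$ is transversal if $|\sigma_x|>0$ for all $x\in V(G)$; $\mathrm{Hom}_+^t(G,H)$ is the subcomplex of $\mathrm{Hom}_+(G,H)$ induced by (i.e. consisting of all faces of) its transversal faces. $\frac{\mathbf 1}{g}=(\frac1g,\dots,\frac1g)\in\mathbb R^g$; $L=\mathbb R^{gh}\times\frac{\mathbf 1}{g}$. For an affine subspace $K$, $\iota_K$ denotes intersection with $K$, applied cell by cell to a family of polytopes (discarding empty intersections). $\pi_\Box:\mathbb R^{gh}\times\mathbb R^g\to\mathbb R^h\times\mathbb R^g$ is the linear map $(x_1,\dots,x_g,y)\mapsto(x_1+\dots+x_g,y)$ with $x_i\in\mathbb R^h$, $y\in\mathbb R^g$; applied to a family of polytopes it denotes the family of images. Thus $\pi_\Box(L)=\mathbb R^h\times\frac{\mathbf 1}{g}$. -}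

module Defs where

open import Level using (Level; _⊔_; suc; 0ℓ)
open import Algebra.Apartness.Bundles using (HeytingField; HeytingCommutativeRing)
open import Algebra.Apartness.Structures using (IsHeytingField)
open import Algebra.Bundles using (Ring; CommutativeRing; AbelianGroup)
open import Algebra.Module.Bundles using (LeftModule)
open import Algebra.Module.Morphism.Structures using (module LeftModuleMorphisms)
import Algebra.Construct.Pointwise as Pointwise
import Algebra.Definitions.RawMonoid as RawMonoid
import Algebra.Module.Construct.DirectProduct as DirectProduct
import Algebra.Module.Construct.TensorUnit as TensorUnit
open import Data.Bool.Base using (if_then_else_)
open import Data.Fin.Base using (Fin)
open import Data.Fin.Properties using (_≟_)
open import Data.Fin.Subset as Subset using (Subset; Nonempty)
open import Data.Nat.Base as ℕ using (ℕ; NonZero)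
open import Data.Product.Base using (∃; ∃-syntax; Σ-syntax; _×_; _,_; proj₁; proj₂)
open import Data.Sum.Base using (_⊎_; inj₂)
open import Data.Vec.Functional using (Vector)
open import Function.Bundles using (_⇔_)
open import Relation.Binary.Core using (Rel)
open import Relation.Binary.Definitions using (Symmetric)
open import Relation.Binary.Structures using (IsStrictPartialOrder)
open import Relation.Nullary.Decidable using (does)
open import Relation.Nullary.Negation using (¬_)
open import Relation.Unary using (Pred; U; _∈_; _⊆_; _≐_; _∩_; _⟨×⟩_; ⋃; Satisfiable)

-- The scalars.  The axioms are those of an ordered field, with apartness
-- x # y taken to be x < y or y < x and without assuming that the order is
-- decidable, so that ℝ is an instance classically as well as constructively.

record OrderedField ℓ : Set (suc ℓ) where
  infix  8 -_
  infixl 7 _*_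
  infixl 6 _+_
  infix  4 _≈_ _<_ _≤_
  field
    Carrier              : Set ℓ
    _≈_ _<_              : Rel Carrier ℓ
    _+_ _*_              : Carrier → Carrier → Carrier
    -_                   : Carrier → Carrier
    0# 1#                : Carrier
    isHeytingField       : IsHeytingField _≈_ (λ x y → x < y ⊎ y < x) _+_ _*_ -_ 0# 1#
    isStrictPartialOrder : IsStrictPartialOrder _≈_ _<_
    +-monoˡ-<            : ∀ z {x y} → x < y → x + z < y + z
    *-pos                : ∀ {x y} → 0# < x → 0# < y → 0# < x * y
    0<1                  : 0# < 1#

  _≤_ : Rel Carrier ℓ
  x ≤ y = ¬ (y < x)

  heytingField : HeytingField ℓ ℓ ℓ
  heytingField = record { isHeytingField = isHeytingField }

  commutativeRing : CommutativeRing ℓ ℓ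
  commutativeRing =
    HeytingCommutativeRing.commutativeRing (HeytingField.heytingCommutativeRing heytingField)

  open CommutativeRing commutativeRing public
    using (ring; +-rawMonoid; +-identityˡ; +-identityʳ)
  open RawMonoid +-rawMonoid public
    using (sum) renaming (_×_ to _·_)

  private
    module < = IsStrictPartialOrder isStrictPartialOrder

  0<[1+n]·1 : ∀ n → 0# < ℕ.suc n · 1#
  0<[1+n]·1 ℕ.zero    = <.<-respʳ-≈ (<.Eq.sym (+-identityʳ 1#)) 0<1
  0<[1+n]·1 (ℕ.suc n) = <.trans (0<[1+n]·1 n)
    (<.<-respˡ-≈ (+-identityˡ _) (+-monoˡ-< (ℕ.suc n · 1#) 0<1))

  -- The inverse of n · 1# - 0#.
  1/_ : (n : ℕ) .{{_ : NonZero n}} → Carrier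
  1/ (ℕ.suc n) = proj₁ (IsHeytingField.#⇒invertible isHeytingField (inj₂ (0<[1+n]·1 n)))

-- Loops are allowed; there is no finiteness condition beyond the vertex set
-- being [n], because parallel edges play no role.

record Graph (n : ℕ) : Set₁ where
  field
    Adj     : Rel (Fin n) 0ℓ
    Adj-sym : Symmetric Adj

-- A labelling σ assigns to each vertex x of G a set σ x ⊆ V(H).  It indexes
-- both the face ⋆ₓ σₓ of the join and the cell ×ₓ σₓ of the product.

Labelling : ℕ → ℕ → Set
Labelling g h = Vector (Subset h) g

module _ {g h : ℕ} where

  infix 4 _⊑_
  _⊑_ : Rel (Labelling g h) 0ℓ
  σ ⊑ τ = ∀ x → σ x Subset.⊆ τ x

  infixr 7 _⊓_
  _⊓_ : Labelling g h → Labelling g h → Labelling g h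
  (σ ⊓ τ) x = σ x Subset.∩ τ x

  Transversal : Pred (Labelling g h) 0ℓ
  Transversal σ = ∀ x → Nonempty (σ x)

module _ {h : ℕ} (H : Graph h) where
  open Graph H

  CompleteBipartite : Rel (Subset h) 0ℓ
  CompleteBipartite A B = ∀ {u v} → u Subset.∈ A → v Subset.∈ B → Adj u v

module _ {g h : ℕ} (G : Graph g) (H : Graph h) where
  open Graph G

  HomCell : Pred (Labelling g h) 0ℓ
  HomCell σ = Transversal σ × (∀ {x y} → Adj x y → CompleteBipartite H (σ x) (σ y))

  Hom₊Face : Pred (Labelling g h) 0ℓ
  Hom₊Face σ = ∀ {x y} → Adj x y → Nonempty (σ x) → Nonempty (σ y) →
               CompleteBipartite H (σ x) (σ y)

  Hom₊ᵗFace : Pred (Labelling g h) 0ℓ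
  Hom₊ᵗFace τ = ∃[ σ ] Hom₊Face σ × Transversal σ × τ ⊑ σ

module Geometry {ℓ : Level} (ℝ : OrderedField ℓ) where
  open OrderedField ℝ

  Space : Set (suc ℓ)
  Space = LeftModule ring ℓ ℓ

  Point : Space → Set ℓ
  Point = LeftModule.Carrierᴹ

  line : Space
  line = TensorUnit.leftModule

  infixr 2 _⊗_
  _⊗_ : Space → Space → Space
  _⊗_ = DirectProduct.leftModule

  infixl 8 _^_
  _^_ : Space → ℕ → Space
  V ^ n = record
    { Carrierᴹ     = Vector V.Carrierᴹ n
    ; _≈ᴹ_         = P._≈_
    ; _+ᴹ_         = P._∙_
    ; _*ₗ_         = λ a x i → a V.*ₗ x i
    ; 0ᴹ           = P.ε
    ; -ᴹ_          = P._⁻¹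
    ; isLeftModule = record
      { isLeftSemimodule = record
        { +ᴹ-isCommutativeMonoid = P.isCommutativeMonoid
        ; isPreleftSemimodule = record
          { *ₗ-cong      = λ a≈b x≈y i → V.*ₗ-cong a≈b (x≈y i)
          ; *ₗ-zeroˡ     = λ x i → V.*ₗ-zeroˡ (x i)
          ; *ₗ-distribʳ  = λ x a b i → V.*ₗ-distribʳ (x i) a b
          ; *ₗ-identityˡ = λ x i → V.*ₗ-identityˡ (x i)
          ; *ₗ-assoc     = λ a b x i → V.*ₗ-assoc a b (x i)
          ; *ₗ-zeroʳ     = λ a i → V.*ₗ-zeroʳ a
          ; *ₗ-distribˡ  = λ a x y i → V.*ₗ-distribˡ a (x i) (y i)
          }
        }
      ; -ᴹ‿cong    = P.⁻¹-cong
      ; -ᴹ‿inverse = P.inverse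
      }
    }
    where
    module V = LeftModule V
    module P = AbelianGroup (Pointwise.abelianGroup (Fin n) V.+ᴹ-abelianGroup)

  ℝ^_ : ℕ → Space
  ℝ^ n = line ^ n

  module _ (V : Space) where
    open LeftModule V

    sumᴹ : ∀ {n} → Vector Carrierᴹ n → Carrierᴹ
    sumᴹ = RawMonoid.sum +ᴹ-rawMonoid

    PointSet : Set (suc ℓ)
    PointSet = Pred Carrierᴹ ℓ

    conv : PointSet → PointSet
    conv S x =
      ∃[ n ] Σ[ w ∈ Vector Carrier n ] Σ[ p ∈ Vector Carrierᴹ n ]
        (∀ k → 0# ≤ w k) × sum w ≈ 1# × (∀ k → p k ∈ S) ×
        x ≈ᴹ sumᴹ (λ k → w k *ₗ p k)

    singleton : Carrierᴹ → PointSet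
    singleton p x = x ≈ᴹ p

    minkowskiSum : ∀ {n} → Vector PointSet n → PointSet
    minkowskiSum A x = Σ[ p ∈ Vector Carrierᴹ _ ] (∀ i → p i ∈ A i) × x ≈ᴹ sumᴹ p

    -- {p} is a face of P: some linear functional attains its maximum over P
    -- exactly at p.
    IsVertex : PointSet → Pred Carrierᴹ ℓ
    IsVertex P p = p ∈ P × (Σ[ φ ∈ (Carrierᴹ → Carrier) ]
      LeftModuleMorphisms.IsLeftModuleHomomorphism rawLeftModule (LeftModule.rawLeftModule line) φ ×
      (∀ {q} → q ∈ P → φ q ≤ φ p × (φ q ≈ φ p → q ≈ᴹ p)))

    μ : ∀ {n} → Fin n → Carrierᴹ → Point (V ^ n)
    μ i x j = if does (i ≟ j) then x else 0ᴹ

    -- Families are sets of polytopes, where polytopes are compared as point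
    -- sets, by _≐_.
    Family : ∀ k → Set (suc ℓ ⊔ suc k)
    Family k = Pred PointSet k

    -- Empty intersections are discarded.
    ι : ∀ {k} → PointSet → Family k → Family (suc ℓ ⊔ k)
    ι K 𝓕 P = ∃[ Q ] Q ∈ 𝓕 × P ≐ Q ∩ K × Satisfiable P

    support : ∀ {k} → Family k → Pred Carrierᴹ (suc ℓ ⊔ k)
    support 𝓕 x = ∃[ P ] P ∈ 𝓕 × x ∈ P

    realise : ∀ {g h} → (Labelling g h → PointSet) → Pred (Labelling g h) 0ℓ → Family ℓ
    realise cell C P = ∃[ σ ] σ ∈ C × P ≐ cell σ

    -- The cells of C are realized faithfully, and they fit together as in a
    -- geometric polytopal complex.
    record IsEmbedded {g h} (cell : Labelling g h → PointSet)
                      (C : Pred (Labelling g h) 0ℓ) : Set ℓ where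
      field
        order-embedding : ∀ {σ τ} → σ ∈ C → τ ∈ C → cell σ ⊆ cell τ ⇔ σ ⊑ τ
        meet            : ∀ {σ τ} → σ ∈ C → τ ∈ C → cell σ ∩ cell τ ≐ cell (σ ⊓ τ)
        meet-cell       : ∀ {σ τ} → σ ∈ C → τ ∈ C →
                          Satisfiable (cell σ ∩ cell τ) → σ ⊓ τ ∈ C

  image : ∀ V W → (Point V → Point W) → PointSet V → PointSet W
  image V W f S y = ∃[ x ] x ∈ S × y ≈ᴹ f x
    where open LeftModule W using (_≈ᴹ_)

  imageᶠ : ∀ {k} V W → (Point V → Point W) → Family V k → Family W (suc ℓ ⊔ k)
  imageᶠ V W f 𝓕 P = ∃[ Q ] Q ∈ 𝓕 × P ≐ image V W f Q

  e : ∀ {n} → Fin n → Point (ℝ^ n)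
  e i = μ line i 1#

  -- The face of Δ spanned by σ; it is empty if σ is.
  face : ∀ {n} → Subset n → PointSet (ℝ^ n)
  face {n} σ = conv (ℝ^ n) λ p → ∃[ v ] v Subset.∈ σ × singleton (ℝ^ n) (e v) p

  Δ : ∀ n → PointSet (ℝ^ n)
  Δ n = face Subset.⊤

  -- The simplex on [g] × [h], in ℝ^{gh} = (ℝ^h)^g.
  Δ× : ∀ g h → PointSet (ℝ^ h ^ g)
  Δ× g h = conv (ℝ^ h ^ g) λ p →
    ∃[ x ] ∃[ v ] singleton (ℝ^ h ^ g) (μ (ℝ^ h) x (e v)) p

  module _ (g h : ℕ) where

    Cayley : Space
    Cayley = ℝ^ h ^ g ⊗ ℝ^ g

    Base : Space
    Base = ℝ^ h ⊗ ℝ^ g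

    π□ : Point Cayley → Point Base
    π□ (x , y) = sumᴹ (ℝ^ h) x , y

    π : PointSet Cayley → PointSet Base
    π = image Cayley Base π□

    πᶠ : ∀ {k} → Family Cayley k → Family Base (suc ℓ ⊔ k)
    πᶠ = imageᶠ Cayley Base π□

    joinCell : Labelling g h → PointSet Cayley
    joinCell σ = conv Cayley (⋃ (Fin g) λ i →
      image (ℝ^ h) (ℝ^ h ^ g) (μ (ℝ^ h) i) (face (σ i)) ⟨×⟩ singleton (ℝ^ g) (e i))

    join : PointSet Cayley
    join = joinCell λ _ → Subset.⊤

    module _ .{{_ : NonZero g}} where

      𝟏/g : Point (ℝ^ g)
      𝟏/g _ = 1/ g

      L : PointSet Cayley
      L (_ , y) = singleton (ℝ^ g) 𝟏/g y

      productCell : Labelling g h → PointSet (ℝ^ h ^ g)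
      productCell σ = image (ℝ^ h ^ g) (ℝ^ h ^ g) (LeftModule._*ₗ_ (ℝ^ h ^ g) (1/ g))
        (minkowskiSum (ℝ^ h ^ g) λ i → image (ℝ^ h) (ℝ^ h ^ g) (μ (ℝ^ h) i) (face (σ i)))

      _×𝟏/g : ∀ {k} → Family (ℝ^ h ^ g) k → Family Cayley (suc ℓ ⊔ k)
      (𝓕 ×𝟏/g) P = ∃[ Q ] Q ∈ 𝓕 × P ≐ (Q ⟨×⟩ singleton (ℝ^ g) 𝟏/g)

  module _ {g h : ℕ} (G : Graph g) (H : Graph h) where

    Hom₊ : Family (Cayley g h) ℓ
    Hom₊ = realise (Cayley g h) (joinCell g h) (Hom₊Face G H)

    Hom₊ᵗ : Family (Cayley g h) ℓ
    Hom₊ᵗ = realise (Cayley g h) (joinCell g h) (Hom₊ᵗFace G H)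

    module _ .{{_ : NonZero g}} where

      Hom : Family (ℝ^ h ^ g) ℓ
      Hom = realise (ℝ^ h ^ g) (productCell g h) (HomCell G H)

      Hom×𝟏/g : Family (Cayley g h) (suc ℓ)
      Hom×𝟏/g = _×𝟏/g g h Hom

      -- The square
      --
      --      𝓚  ── ι_L ──→  Hom × 𝟏/g
      --      │                  │
      --      π                  π
      --      ↓                  ↓
      --     π 𝓚 ─ ι_{πL} → π (Hom × 𝟏/g)
      --
      -- The horizontal maps are partial, as empty intersections are discarded.
      -- The vertical maps take values in the bottom row by definition of πᶠ.
      record Square (𝓚 : Family (Cayley g h) ℓ) : Set (suc ℓ) where
        field
          top-defined    : ∀ {P} → P ∈ 𝓚 → Satisfiable (P ∩ L g h) →
                           P ∩ L g h ∈ Hom×𝟏/g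
          bottom-defined : ∀ {Q} → Q ∈ πᶠ g h 𝓚 → Satisfiable (Q ∩ π g h (L g h)) →
                           Q ∩ π g h (L g h) ∈ πᶠ g h Hom×𝟏/g
          discards       : ∀ {P} → P ∈ 𝓚 →
                           Satisfiable (P ∩ L g h) ⇔ Satisfiable (π g h P ∩ π g h (L g h))
          commutes       : ∀ {P} → P ∈ 𝓚 →
                           π g h (P ∩ L g h) ≐ π g h P ∩ π g h (L g h)

          𝓚-faces        : 𝓚 ⊆ realise (Cayley g h) (joinCell g h) U
          𝓚-support      : support (Cayley g h) 𝓚 ⊆ join g h
          Hom-support    : support (Cayley g h) Hom×𝟏/g ⊆
                           (Δ× g h ⟨×⟩ singleton (ℝ^ g) (𝟏/g g h))
          π𝓚-support     : support (Base g h) (πᶠ g h 𝓚) ⊆ (Δ h ⟨×⟩ Δ g)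
          πHom-support   : support (Base g h) (πᶠ g h Hom×𝟏/g) ⊆
                           (Δ h ⟨×⟩ singleton (ℝ^ g) (𝟏/g g h))

          hull-of-vertices : ∀ {P} → P ∈ 𝓚 → Σ[ S ∈ PointSet (Base g h) ]
                             S ⊆ IsVertex (Base g h) (Δ h ⟨×⟩ Δ g) ×
                             π g h P ≐ conv (Base g h) S
          sections         : πᶠ g h Hom×𝟏/g ≐ ι (Base g h) (π g h (L g h)) (πᶠ g h 𝓚)

{-# OPTIONS --safe #-}
module Submission where

-- Everything is read off coordinates.  A point (X , y) lies in the cell ⋆ᵢ σᵢ
-- iff X is nonnegative, vanishes outside the σᵢ, its i-th block has total yᵢ,
-- and the yᵢ sum to 1; a point X lies in the cell ×ᵢ σᵢ iff it satisfies the
-- same conditions with all yᵢ = 1/g.  So intersecting with L turns ⋆ᵢ σᵢ into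
-- ×ᵢ σᵢ, and leaves nothing if some σᵢ is empty.  Both inclusions between
-- π(P ∩ L) and π(P) ∩ π(L) hold because π□ does not touch y.  Finally π□ maps
-- the vertices of ⋆ᵢ σᵢ to the points (eᵥ , eᵢ), each of which is the only
-- maximum of (x , y) ↦ xᵥ + yᵢ on the product of simplices.

open import Defs
open import Level using (0ℓ)
open import Algebra.Apartness.Structures using (IsHeytingField)
open import Algebra.Bundles using (CommutativeRing)
open import Algebra.Module.Bundles using (LeftModule)
open import Algebra.Module.Morphism.Structures using (module LeftModuleMorphisms)
import Algebra.Module.Properties.LeftModule as LeftModuleProperties
import Algebra.Properties.CommutativeMonoid.Sum as CommutativeMonoidSum
import Algebra.Properties.CommutativeSemigroup as CommutativeSemigroupProperties
import Algebra.Properties.Ring as RingProperties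
import Algebra.Properties.Semiring.Sum as SemiringSum
open import Data.Fin.Base using (Fin; zero; suc; punchIn; punchOut)
open import Data.Fin.Properties using (_≟_; punchInᵢ≢i; punchIn-punchOut)
open import Data.Fin.Subset as Subset using (Subset; Nonempty)
open import Data.Fin.Subset.Properties
  using (_∈?_; nonempty?; ∈⊤; x∈p∩q⁺; p∩q⊆p; p∩q⊆q)
open import Data.Nat.Base as ℕ using (ℕ; NonZero)
open import Data.Product.Base using (∃-syntax; Σ-syntax; _×_; _,_; proj₁; proj₂; map)
open import Data.Sum.Base using (_⊎_; inj₁; inj₂; [_,_]′)
open import Data.Vec.Functional as Vector using (Vector; removeAt)
open import Function.Base using (_∘_; id; const)
open import Function.Bundles using (mk⇔)
open import Relation.Binary.PropositionalEquality.Core as ≡ using (_≡_; _≢_)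
open import Relation.Binary.Structures using (IsStrictPartialOrder)
open import Relation.Nullary.Decidable using (yes; no; decidable-stable)
open import Relation.Nullary.Negation using (¬_; contradiction)
open import Relation.Unary using (Pred; _∈_; _⊆_; _≐_; _∩_; _⟨×⟩_; ⋃; Satisfiable)

-- Arithmetic and inequalities in an ordered field with undecided order.

module OrderedFieldProperties {ℓ} (ℝ : OrderedField ℓ) where

  open OrderedField ℝ
  open CommutativeRing commutativeRing
    using (setoid; semiring; refl; sym; trans; +-comm; +-congˡ; +-congʳ;
           *-comm; *-assoc; *-congˡ; *-congʳ; *-identityˡ; zeroʳ; -‿cong; -‿inverseˡ; -‿inverseʳ)
  open RingProperties ring using (-0#≈0#; -‿distribʳ-*; //-rightDividesʳ)
  open SemiringSum semiring using (sum-cong-≋; sum-replicate; *-distribʳ-sum)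
  open import Relation.Binary.Reasoning.Setoid setoid
  open IsHeytingField isHeytingField using (#⇒invertible; invertible⇒#; tight; #-cotrans)
  private
    module < = IsStrictPartialOrder isStrictPartialOrder
    variable
      x y z : Carrier

  ≤-reflexive : x ≈ y → x ≤ y
  ≤-reflexive x≈y y<x = <.irrefl (sym x≈y) y<x

  ≤-respʳ-≈ : x ≈ y → z ≤ x → z ≤ y
  ≤-respʳ-≈ x≈y z≤x y<z = z≤x (<.<-respˡ-≈ (sym x≈y) y<z)

  -- The two hypotheses refute both ways of being apart, and the apartness is tight.
  ≤-antisym : x ≤ y → y ≤ x → x ≈ y
  ≤-antisym x≤y y≤x = proj₁ (tight _ _) [ y≤x , x≤y ]′

  <⇒≤ : x < y → x ≤ y
  <⇒≤ x<y y<x = <.asym x<y y<x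

  1≉0 : ¬ 1# ≈ 0#
  1≉0 1≈0 = <.irrefl (sym 1≈0) 0<1

  +-cancelʳ-< : x + z < y + z → x < y
  +-cancelʳ-< {x} {z} {y} p = <.<-respˡ-≈ (//-rightDividesʳ z x)
    (<.<-respʳ-≈ (//-rightDividesʳ z y) (+-monoˡ-< (- z) p))

  -- The field axioms tie apartness to invertibility of a difference; this lets apartness from `0#`
  -- be read as invertibility of the element itself.
  x-0≈x : ∀ x → x + - 0# ≈ x
  x-0≈x x = trans (+-congˡ -0#≈0#) (+-identityʳ x)

  -- Signs cannot be decided, but cotransitivity applied to `x + y < 0#` makes `y` apart from
  -- `x + y` or from `0#`. Each resulting strict inequality makes one of the summands negative.
  0≤x+y : 0# ≤ x → 0# ≤ y → 0# ≤ x + y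
  0≤x+y {x} {y} 0≤x 0≤y x+y<0 with #-cotrans (inj₁ x+y<0) y
  ... | inj₁ (inj₁ x+y<y) = 0≤x (+-cancelʳ-< (<.<-respʳ-≈ (sym (+-identityˡ y)) x+y<y))
  ... | inj₁ (inj₂ y<x+y) = 0≤y (<.trans y<x+y x+y<0)
  ... | inj₂ (inj₁ y<0)   = 0≤y y<0
  ... | inj₂ (inj₂ 0<y)   =
    0≤x (+-cancelʳ-< (<.<-respʳ-≈ (sym (+-identityˡ y)) (<.trans x+y<0 0<y)))

  -- A negative product is apart from `0#`, hence invertible, so both factors are invertible and
  -- thus apart from `0#`. Being nonnegative they are positive, and then so is the product.
  0≤x*y : 0# ≤ x → 0# ≤ y → 0# ≤ x * y
  0≤x*y {x} {y} 0≤x 0≤y xy<0 with #⇒invertible (inj₁ xy<0)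
  ... | i , i*xy≈1 , xy*i≈1 = <.asym xy<0 (*-pos (pos 0≤x x#0) (pos 0≤y y#0))
    where
    xy*i : x * y * i ≈ 1#
    xy*i = trans (*-congʳ (sym (x-0≈x (x * y)))) xy*i≈1
    pos : ∀ {z} → 0# ≤ z → z < 0# ⊎ 0# < z → 0# < z
    pos 0≤z = [ (λ z<0 → contradiction z<0 0≤z) , id ]′
    inv : ∀ {z j} → z * j ≈ 1# → z < 0# ⊎ 0# < z
    inv {z} {j} zj≈1 = invertible⇒#
      (j , trans (*-comm _ _) zj′ , zj′)
      where
      zj′ : (z + - 0#) * j ≈ 1#
      zj′ = trans (*-congʳ (x-0≈x z)) zj≈1
    x#0 = inv (trans (sym (*-assoc x y i)) xy*i)
    y#0 = inv (trans (trans (sym (*-assoc y x i)) (*-congʳ (*-comm y x))) xy*i)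

  x+z≈y⇒x≤y : 0# ≤ z → x + z ≈ y → x ≤ y
  x+z≈y⇒x≤y {z} {x} 0≤z x+z≈y y<x = 0≤z (+-cancelʳ-<
    (<.<-respˡ-≈ (trans (sym x+z≈y) (+-comm x z)) (<.<-respʳ-≈ (sym (+-identityˡ x)) y<x)))

  x+y≈0⇒x≈0 : 0# ≤ x → 0# ≤ y → x + y ≈ 0# → x ≈ 0#
  x+y≈0⇒x≈0 0≤x 0≤y x+y≈0 = ≤-antisym (x+z≈y⇒x≤y 0≤y x+y≈0) 0≤x

  0≤sum : ∀ {n} {a : Vector Carrier n} → (∀ i → 0# ≤ a i) → 0# ≤ sum a
  0≤sum {ℕ.zero}  0≤a = ≤-reflexive refl
  0≤sum {ℕ.suc n} 0≤a = 0≤x+y (0≤a zero) (0≤sum (0≤a ∘ suc))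

  sum≈0⇒≈0 : ∀ {n} {a : Vector Carrier n} → (∀ i → 0# ≤ a i) → sum a ≈ 0# → ∀ i → a i ≈ 0#
  sum≈0⇒≈0 0≤a Σ≈0 zero    = x+y≈0⇒x≈0 (0≤a zero) (0≤sum (0≤a ∘ suc)) Σ≈0
  sum≈0⇒≈0 0≤a Σ≈0 (suc i) = sum≈0⇒≈0 (0≤a ∘ suc)
    (x+y≈0⇒x≈0 (0≤sum (0≤a ∘ suc)) (0≤a zero) (trans (+-comm _ _) Σ≈0)) i

  n·1*1/n≈1 : ∀ n .{{_ : NonZero n}} → n · 1# * 1/ n ≈ 1#
  n·1*1/n≈1 (ℕ.suc n) = trans (*-congʳ (sym (x-0≈x _)))
    (proj₂ (proj₂ (#⇒invertible (inj₂ (0<[1+n]·1 n)))))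

  1/n≉0 : ∀ n .{{_ : NonZero n}} → ¬ 1/ n ≈ 0#
  1/n≉0 n 1/n≈0 = 1≉0 (trans (sym (n·1*1/n≈1 n)) (trans (*-congˡ 1/n≈0) (zeroʳ _)))

  0≤n·1 : ∀ n → 0# ≤ n · 1#
  0≤n·1 ℕ.zero    = ≤-reflexive refl
  0≤n·1 (ℕ.suc n) = <⇒≤ (0<[1+n]·1 n)

  0<-x : x < 0# → 0# < - x
  0<-x {x} x<0 = <.<-respˡ-≈ (-‿inverseʳ x) (<.<-respʳ-≈ (+-identityˡ (- x)) (+-monoˡ-< (- x) x<0))

  -- If `1/ n` were negative, multiplying its opposite by the positive `n · 1#` would make `- 1#`
  -- positive, against `0# < 1#`.
  0≤1/n : ∀ n .{{_ : NonZero n}} → 0# ≤ 1/ n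
  0≤1/n (ℕ.suc n) 1/n<0 = <.asym 0<1
    (<.<-respˡ-≈ (+-identityˡ 1#) (<.<-respʳ-≈ (-‿inverseˡ 1#) (+-monoˡ-< 1# 0<-1)))
    where
    0<-1 : 0# < - 1#
    0<-1 = <.<-respʳ-≈
      (trans (sym (-‿distribʳ-* (ℕ.suc n · 1#) (1/ (ℕ.suc n)))) (-‿cong (n·1*1/n≈1 (ℕ.suc n))))
      (*-pos (0<[1+n]·1 n) (0<-x 1/n<0))

  sum-1/n : ∀ n .{{_ : NonZero n}} → sum {n} (λ _ → 1/ n) ≈ 1#
  sum-1/n n = begin
    sum {n} (λ _ → 1/ n)       ≈⟨ sum-cong-≋ {n} (λ _ → sym (*-identityˡ (1/ n))) ⟩
    sum {n} (λ _ → 1# * 1/ n)  ≈⟨ *-distribʳ-sum {n} (1/ n) (λ _ → 1#) ⟨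
    sum {n} (λ _ → 1#) * 1/ n  ≈⟨ *-congʳ (sum-replicate n) ⟩
    n · 1# * 1/ n              ≈⟨ n·1*1/n≈1 n ⟩
    1#                         ∎

module ConvexGeometry {ℓ} (ℝ : OrderedField ℓ) where

  open OrderedField ℝ
  open OrderedFieldProperties ℝ
  open Geometry ℝ
  open CommutativeRing commutativeRing
    using (semiring; refl; sym; trans; +-assoc; +-comm; +-cong; +-congˡ; +-congʳ;
           *-comm; *-assoc; *-congˡ; *-congʳ; *-identityˡ; *-identityʳ; zeroʳ; distribˡ)
  open SemiringSum semiring
    using (sum-cong-≋; sum-remove; sum-replicate-zero; ∑-distrib-+; *-distribˡ-sum)
  open RingProperties ring using (+-identityʳ-unique)

  -- Linear maps, sums and block inclusions.

  Linear : ∀ V W → (Point V → Point W) → Set ℓ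
  Linear V W = LeftModuleMorphisms.IsLeftModuleHomomorphism
    (LeftModule.rawLeftModule V) (LeftModule.rawLeftModule W)

  module Linear {V W} {f : Point V → Point W} (f-linear : Linear V W f) =
    LeftModuleMorphisms.IsLeftModuleHomomorphism f-linear

  module _ (V W : Space) {f : Point V → Point W} where
    private
      module V = LeftModule V
      module W = LeftModule W

    -- Preservation of zero and of negatives is derived: `0ᴹ` is `0#` times itself, and additive
    -- inverses are unique.
    linear : (∀ {x y} → x V.≈ᴹ y → f x W.≈ᴹ f y) →
             (∀ x y → f (x V.+ᴹ y) W.≈ᴹ f x W.+ᴹ f y) →
             (∀ c x → f (c V.*ₗ x) W.≈ᴹ c W.*ₗ f x) →
             Linear V W f
    linear f-cong f-+ f-* = record
      { +ᴹ-isGroupHomomorphism = record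
        { isMonoidHomomorphism = record
          { isMagmaHomomorphism = record
            { isRelHomomorphism = record { cong = f-cong }
            ; homo = f-+
            }
          ; ε-homo = f-0
          }
        ; ⁻¹-homo = λ x → LeftModuleProperties.inverseˡ-uniqueᴹ W _ _
            (W.≈ᴹ-trans (W.≈ᴹ-sym (f-+ _ _)) (W.≈ᴹ-trans (f-cong (V.-ᴹ‿inverseˡ x)) f-0))
        }
      ; *ₗ-homo = f-*
      }
      where
      f-0 : f V.0ᴹ W.≈ᴹ W.0ᴹ
      f-0 = W.≈ᴹ-trans (f-cong (V.≈ᴹ-sym (V.*ₗ-zeroˡ V.0ᴹ)))
        (W.≈ᴹ-trans (f-* 0# V.0ᴹ) (W.*ₗ-zeroˡ (f V.0ᴹ)))

  module _ (V W : Space) {f : Point V → Point W} (f-linear : Linear V W f) where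
    private
      module V = LeftModule V
      module W = LeftModule W
      module f = Linear {V} {W} f-linear

    sum-homo : ∀ {n} (x : Vector V.Carrierᴹ n) → f (sumᴹ V x) W.≈ᴹ sumᴹ W (f ∘ x)
    sum-homo {ℕ.zero}  x = f.0ᴹ-homo
    sum-homo {ℕ.suc n} x = W.≈ᴹ-trans (f.+ᴹ-homo _ _) (W.+ᴹ-congˡ (sum-homo (x ∘ suc)))

  module _ (V : Space) where
    private
      module V = LeftModule V
      module Σ = CommutativeMonoidSum V.+ᴹ-commutativeMonoid

    sumᴹ-cong : ∀ {n} {x y : Vector V.Carrierᴹ n} →
                (∀ i → x i V.≈ᴹ y i) → sumᴹ V x V.≈ᴹ sumᴹ V y
    sumᴹ-cong = Σ.sum-cong-≋

    sumᴹ-single : ∀ {n} (i : Fin n) {x : Vector V.Carrierᴹ n} →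
                  (∀ j → i ≢ j → x j V.≈ᴹ V.0ᴹ) → sumᴹ V x V.≈ᴹ x i
    sumᴹ-single {ℕ.suc n} i {x} x≈0 = V.≈ᴹ-trans (Σ.sum-remove {i = i} x)
      (V.≈ᴹ-trans (V.+ᴹ-congˡ (V.≈ᴹ-trans
        (sumᴹ-cong (λ j → x≈0 (punchIn i j) (≡.≢-sym (punchInᵢ≢i i j)))) (Σ.sum-replicate-zero n)))
        (V.+ᴹ-identityʳ (x i)))

    μ-diag : ∀ {n} (i : Fin n) x → μ V i x i V.≈ᴹ x
    μ-diag i x with i ≟ i
    ... | yes _  = V.≈ᴹ-refl
    ... | no i≢i = contradiction ≡.refl i≢i

    μ-off : ∀ {n} {i j : Fin n} x → i ≢ j → μ V i x j V.≈ᴹ V.0ᴹ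
    μ-off {i = i} {j} x i≢j with i ≟ j
    ... | yes i≡j = contradiction i≡j i≢j
    ... | no _    = V.≈ᴹ-refl

    μ-linear : ∀ {n} (i : Fin n) → Linear V (V ^ n) (μ V i)
    μ-linear {n} i = linear V (V ^ n) μ-cong μ-+ μ-*
      where
      μ-cong : ∀ {x y} → x V.≈ᴹ y → ∀ j → μ V i x j V.≈ᴹ μ V i y j
      μ-cong x≈y j with i ≟ j
      ... | yes _ = x≈y
      ... | no _  = V.≈ᴹ-refl
      μ-+ : ∀ x y j → μ V i (x V.+ᴹ y) j V.≈ᴹ μ V i x j V.+ᴹ μ V i y j
      μ-+ x y j with i ≟ j
      ... | yes _ = V.≈ᴹ-refl
      ... | no _  = V.≈ᴹ-sym (V.+ᴹ-identityˡ V.0ᴹ)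
      μ-* : ∀ c x j → μ V i (c V.*ₗ x) j V.≈ᴹ c V.*ₗ μ V i x j
      μ-* c x j with i ≟ j
      ... | yes _ = V.≈ᴹ-refl
      ... | no _  = V.≈ᴹ-sym (V.*ₗ-zeroʳ c)

    lookup-linear : ∀ {n} (i : Fin n) → Linear (V ^ n) V (λ x → x i)
    lookup-linear {n} i = linear (V ^ n) V (λ x≈y → x≈y i) (λ _ _ → V.≈ᴹ-refl) (λ _ _ → V.≈ᴹ-refl)

    *ₗ-linear : ∀ x → Linear line V (V._*ₗ x)
    *ₗ-linear x = linear line V V.*ₗ-congʳ (V.*ₗ-distribʳ x) (λ c t → V.*ₗ-assoc c t x)

    sumᴹ-linear : ∀ n → Linear (V ^ n) V (sumᴹ V)
    sumᴹ-linear n = linear (V ^ n) V sumᴹ-cong Σ.∑-distrib-+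
      (λ c x → V.≈ᴹ-sym (sum-homo V V (c*-linear c) x))
      where
      c*-linear : ∀ c → Linear V V (c V.*ₗ_)
      c*-linear c = linear V V V.*ₗ-congˡ (V.*ₗ-distribˡ c) λ d x →
        V.≈ᴹ-trans (V.≈ᴹ-sym (V.*ₗ-assoc c d x))
          (V.≈ᴹ-trans (V.*ₗ-congʳ (*-comm c d)) (V.*ₗ-assoc d c x))

    -- This decomposes a point into its blocks: at coordinate `j` only the `j`-th summand survives.
    sumᴹ-μ : ∀ {n} (x : Point (V ^ n)) → let open LeftModule (V ^ n) in
             sumᴹ (V ^ n) (λ i → μ V i (x i)) ≈ᴹ x
    sumᴹ-μ {n} x j = V.≈ᴹ-trans (sum-homo (V ^ n) V (lookup-linear j) (λ i → μ V i (x i)))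
      (V.≈ᴹ-trans (sumᴹ-single j (λ i j≢i → μ-off (x i) (≡.≢-sym j≢i))) (μ-diag j (x j)))

    sum-μ : ∀ {n} (i : Fin n) x → sumᴹ V (μ V i x) V.≈ᴹ x
    sum-μ i x = V.≈ᴹ-trans (sumᴹ-single i (λ j → μ-off x)) (μ-diag i x)

  proj₁-linear : ∀ V W → Linear (V ⊗ W) V proj₁
  proj₁-linear V W = linear (V ⊗ W) V proj₁ (λ _ _ → V.≈ᴹ-refl) (λ _ _ → V.≈ᴹ-refl)
    where module V = LeftModule V

  proj₂-linear : ∀ V W → Linear (V ⊗ W) W proj₂
  proj₂-linear V W = linear (V ⊗ W) W proj₂ (λ _ _ → W.≈ᴹ-refl) (λ _ _ → W.≈ᴹ-refl)
    where module W = LeftModule W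

  π□-linear : ∀ g h → Linear (Cayley g h) (Base g h) (π□ g h)
  π□-linear g h = linear (Cayley g h) (Base g h) (map Σ.⟦⟧-cong id)
    (λ x y → Σ.+ᴹ-homo (proj₁ x) (proj₁ y) , λ _ → refl)
    (λ c x → Σ.*ₗ-homo c (proj₁ x) , λ _ → refl)
    where module Σ = Linear {ℝ^ h ^ g} {ℝ^ h} (sumᴹ-linear (ℝ^ h) g)

  -- Conic families and convex hulls.

  -- T t x reads "x is t times a point of a given convex set".  Carrying the
  -- factor t along makes the condition stable under sums, so that no division
  -- by a possibly vanishing partial weight is ever needed.
  record IsConic (V : Space) (T : Carrier → PointSet V) : Set ℓ where
    open LeftModule V
    field
      resp  : ∀ {s t x y} → s ≈ t → x ≈ᴹ y → T s x → T t y
      zeroᶜ : T 0# 0ᴹ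
      add   : ∀ {s t x y} → T s x → T t y → T (s + t) (x +ᴹ y)
      scale : ∀ {c t x} → 0# ≤ c → T t x → T (c * t) (c *ₗ x)

    sumᶜ : ∀ {n} {t : Vector Carrier n} {x : Vector Carrierᴹ n} →
           (∀ k → T (t k) (x k)) → T (sum t) (sumᴹ V x)
    sumᶜ {ℕ.zero}  Tx = zeroᶜ
    sumᶜ {ℕ.suc n} Tx = add (Tx zero) (sumᶜ (Tx ∘ suc))

    scale₁ : ∀ {c x} → 0# ≤ c → T 1# x → T c (c *ₗ x)
    scale₁ 0≤c Tx = resp (*-identityʳ _) ≈ᴹ-refl (scale 0≤c Tx)

    -- Each generator is scaled by its nonnegative weight, and the scales add up to `1#`.
    conv⊆ : ∀ {S} → S ⊆ T 1# → conv V S ⊆ T 1#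
    conv⊆ S⊆T (n , w , p , 0≤w , Σw≈1 , p∈S , x≈) =
      resp Σw≈1 (≈ᴹ-sym x≈) (sumᶜ (λ k → scale₁ (0≤w k) (S⊆T (p∈S k))))

  module _ (V : Space) where
    open LeftModule V

    -- The definition of `conv` with total weight `t`, so that `conv V S` unfolds to `cone V S 1#`.
    cone : PointSet V → Carrier → PointSet V
    cone S t x =
      ∃[ n ] Σ[ w ∈ Vector Carrier n ] Σ[ p ∈ Vector Carrierᴹ n ]
        (∀ k → 0# ≤ w k) × sum w ≈ t × (∀ k → p k ∈ S) ×
        x ≈ᴹ sumᴹ V (λ k → w k *ₗ p k)

    conv-extensive : ∀ {S} → S ⊆ conv V S
    conv-extensive {S} {x} x∈S = 1 , const 1# , const x , (λ _ → <⇒≤ 0<1) , +-identityʳ 1# ,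
      const x∈S , ≈ᴹ-sym (≈ᴹ-trans (+ᴹ-identityʳ _) (*ₗ-identityˡ x))

    module _ {S : PointSet V} where

      cone-resp : ∀ {s t x y} → s ≈ t → x ≈ᴹ y → cone S s x → cone S t y
      cone-resp s≈t x≈y (n , w , p , 0≤w , Σw , p∈S , x≈) =
        n , w , p , 0≤w , trans Σw s≈t , p∈S , ≈ᴹ-trans (≈ᴹ-sym x≈y) x≈

      cone-cons : ∀ {c p t x} → 0# ≤ c → p ∈ S → cone S t x → cone S (c + t) (c *ₗ p +ᴹ x)
      cone-cons {c} {p} 0≤c p∈S (n , w , q , 0≤w , Σw , q∈S , x≈) =
        ℕ.suc n , c Vector.∷ w , p Vector.∷ q ,
        (λ { zero → 0≤c ; (suc k) → 0≤w k }) , +-congˡ Σw ,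
        (λ { zero → p∈S ; (suc k) → q∈S k }) , +ᴹ-congˡ x≈

      cone-++ : ∀ m {w : Vector Carrier m} {p : Vector Carrierᴹ m} {t x} →
                (∀ k → 0# ≤ w k) → (∀ k → p k ∈ S) → cone S t x →
                cone S (sum w + t) (sumᴹ V (λ k → w k *ₗ p k) +ᴹ x)
      cone-++ ℕ.zero    0≤w p∈S x∈ = cone-resp (sym (+-identityˡ _)) (≈ᴹ-sym (+ᴹ-identityˡ _)) x∈
      cone-++ (ℕ.suc m) 0≤w p∈S x∈ = cone-resp (sym (+-assoc _ _ _)) (≈ᴹ-sym (+ᴹ-assoc _ _ _))
        (cone-cons (0≤w zero) (p∈S zero) (cone-++ m (0≤w ∘ suc) (p∈S ∘ suc) x∈))

      cone-isConic : IsConic V (cone S)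
      cone-isConic = record
        { resp  = cone-resp
        ; zeroᶜ = 0 , (λ ()) , (λ ()) , (λ ()) , refl , (λ ()) , ≈ᴹ-refl
        ; add   = λ { (m , _ , _ , 0≤w , Σw , p∈S , x≈) y∈ →
            cone-resp (+-congʳ Σw) (+ᴹ-congʳ (≈ᴹ-sym x≈)) (cone-++ m 0≤w p∈S y∈) }
        ; scale = λ { {c} 0≤c (n , w , p , 0≤w , Σw , p∈S , x≈) →
            n , (λ k → c * w k) , p , (λ k → 0≤x*y 0≤c (0≤w k)) ,
            trans (sym (*-distribˡ-sum c w)) (*-congˡ Σw) , p∈S ,
            ≈ᴹ-trans (*ₗ-congˡ x≈) (≈ᴹ-trans
              (≈ᴹ-sym (Linear.*ₗ-homo {V ^ n} {V} (sumᴹ-linear V n) c (λ k → w k *ₗ p k)))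
              (sumᴹ-cong V (λ k → ≈ᴹ-sym (*ₗ-assoc c (w k) (p k))))) }
        }

  module _ (V W : Space) {f : Point V → Point W} (f-linear : Linear V W f) where
    private
      module V = LeftModule V
      module W = LeftModule W
      module f = Linear {V} {W} f-linear

    -- With this, a property of `f x` can itself serve as the conic family that is checked on the
    -- generators of a cell.
    preimage-isConic : ∀ {T} → IsConic W T → IsConic V (λ t x → T t (f x))
    preimage-isConic T-conic = record
      { resp  = λ s≈t x≈y → resp s≈t (f.⟦⟧-cong x≈y)
      ; zeroᶜ = resp refl (W.≈ᴹ-sym f.0ᴹ-homo) zeroᶜ
      ; add   = λ Tx Ty → resp refl (W.≈ᴹ-sym (f.+ᴹ-homo _ _)) (add Tx Ty)
      ; scale = λ 0≤c Tx → resp refl (W.≈ᴹ-sym (f.*ₗ-homo _ _)) (scale 0≤c Tx)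
      }
      where open IsConic T-conic

    image-isConic : ∀ {T} → IsConic V T → IsConic W (λ t → image V W f (T t))
    image-isConic T-conic = record
      { resp  = λ { s≈t y≈z (x , Tx , y≈) →
          x , resp s≈t V.≈ᴹ-refl Tx , W.≈ᴹ-trans (W.≈ᴹ-sym y≈z) y≈ }
      ; zeroᶜ = _ , zeroᶜ , W.≈ᴹ-sym f.0ᴹ-homo
      ; add   = λ { (_ , Tx , y≈) (_ , Tx′ , y′≈) →
          _ , add Tx Tx′ , W.≈ᴹ-trans (W.+ᴹ-cong y≈ y′≈) (W.≈ᴹ-sym (f.+ᴹ-homo _ _)) }
      ; scale = λ { 0≤c (_ , Tx , y≈) →
          _ , scale 0≤c Tx , W.≈ᴹ-trans (W.*ₗ-congˡ y≈) (W.≈ᴹ-sym (f.*ₗ-homo _ _)) }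
      }
      where open IsConic T-conic

  -- Faces of a simplex in barycentric coordinates.

  +-interchange : ∀ w x y z → (w + x) + (y + z) ≈ (w + y) + (x + z)
  +-interchange = CommutativeSemigroupProperties.interchange
    (CommutativeRing.+-commutativeSemigroup commutativeRing)

  sumᴹ-e : ∀ {n} (a : Vector Carrier n) → let open LeftModule (ℝ^ n) in
           sumᴹ (ℝ^ n) (λ v → a v *ₗ e v) ≈ᴹ a
  sumᴹ-e {n} a = ≈ᴹ-trans (sumᴹ-cong (ℝ^ n) a*e≈μ) (sumᴹ-μ line a)
    where
    open LeftModule (ℝ^ n)
    a*e≈μ : ∀ v → a v *ₗ e v ≈ᴹ μ line v (a v)
    a*e≈μ v = ≈ᴹ-trans
      (≈ᴹ-sym (Linear.*ₗ-homo {line} {ℝ^ n} (μ-linear line v) (a v) 1#))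
      (Linear.⟦⟧-cong {line} {ℝ^ n} (μ-linear line v) (*-identityʳ (a v)))

  -- These are the points of `t` times the face spanned by `σ`, described by coordinates instead of
  -- by convex combinations.
  record Weights {n} (σ : Subset n) (t : Carrier) (a : Vector Carrier n) : Set ℓ where
    field
      0≤      : ∀ v → 0# ≤ a v
      outside : ∀ {v} → v Subset.∉ σ → a v ≈ 0#
      total   : sum a ≈ t

  open Weights

  module _ {n} {σ : Subset n} where

    Weights-isConic : IsConic (ℝ^ n) (Weights σ)
    Weights-isConic = record
      { resp  = λ s≈t a≈b A → record
        { 0≤      = λ v → ≤-respʳ-≈ (a≈b v) (0≤ A v)
        ; outside = λ v∉σ → trans (sym (a≈b _)) (outside A v∉σ)
        ; total   = trans (sum-cong-≋ (λ v → sym (a≈b v))) (trans (total A) s≈t)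
        }
      ; zeroᶜ = record
        { 0≤      = λ _ → ≤-reflexive refl
        ; outside = λ _ → refl
        ; total   = sum-replicate-zero n
        }
      ; add   = λ {_} {_} {a} {b} A B → record
        { 0≤      = λ v → 0≤x+y (0≤ A v) (0≤ B v)
        ; outside = λ v∉σ → trans (+-cong (outside A v∉σ) (outside B v∉σ)) (+-identityˡ 0#)
        ; total   = trans (∑-distrib-+ a b) (+-cong (total A) (total B))
        }
      ; scale = λ {c} {t} {a} 0≤c A → record
        { 0≤      = λ v → 0≤x*y 0≤c (0≤ A v)
        ; outside = λ v∉σ → trans (*-congˡ (outside A v∉σ)) (zeroʳ c)
        ; total   = trans (sym (*-distribˡ-sum c a)) (*-congˡ (total A))
        }
      }

    0≤total : ∀ {t a} → Weights σ t a → 0# ≤ t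
    0≤total A = ≤-respʳ-≈ (total A) (0≤sum (0≤ A))

    -- Over an empty `σ` every coordinate vanishes, and with them the total. Nonemptiness of a
    -- finite subset is decidable, so arguing by contradiction is allowed.
    Weights-nonempty : ∀ {t a} → ¬ t ≈ 0# → Weights σ t a → Nonempty σ
    Weights-nonempty t≉0 A = decidable-stable (nonempty? σ) λ empty →
      t≉0 (trans (sym (total A)) (trans
        (sum-cong-≋ (λ v → outside A (λ v∈σ → empty (v , v∈σ)))) (sum-replicate-zero n)))

    Weights-∈ : ∀ {s t a v} → ¬ s ≈ 0# → a v ≈ s → Weights σ t a → v Subset.∈ σ
    Weights-∈ {v = v} s≉0 aᵥ≈s A = decidable-stable (v ∈? σ) λ v∉σ →
      s≉0 (trans (sym aᵥ≈s) (outside A v∉σ))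

    Weights-e : ∀ {v} → v Subset.∈ σ → Weights σ 1# (e v)
    Weights-e {v} v∈σ = record
      { 0≤      = λ w → nonneg w
      ; outside = λ {w} w∉σ → μ-off line {i = v} {w} 1# (λ { ≡.refl → w∉σ v∈σ })
      ; total   = sum-μ line v 1#
      }
      where
      nonneg : ∀ w → 0# ≤ e v w
      nonneg w with v ≟ w
      ... | yes _ = <⇒≤ 0<1
      ... | no  _ = ≤-reflexive refl

    -- The coordinates of `a` act as the coefficients of a combination of the `q v`, so a conic
    -- condition need only be checked at the vertices in `σ`.
    Weights⇒conic : ∀ {V T} → let open LeftModule V in
                    IsConic V T → ∀ {q : Fin n → Carrierᴹ} → (∀ {v} → v Subset.∈ σ → T 1# (q v)) →
                    ∀ {t a} → Weights σ t a → T t (sumᴹ V (λ v → a v *ₗ q v))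
    Weights⇒conic {V} {T} T-conic {q} Tq {t} {a} A = resp (total A) ≈ᴹ-refl (sumᶜ term)
      where
      open LeftModule V
      open IsConic T-conic
      term : ∀ v → T (a v) (a v *ₗ q v)
      term v with v ∈? σ
      ... | yes v∈σ = scale₁ (0≤ A v) (Tq v∈σ)
      -- Nothing is known about `q v` here, but its coefficient vanishes and the term is zero.
      ... | no v∉σ  = resp (sym (outside A v∉σ))
        (≈ᴹ-sym (≈ᴹ-trans (*ₗ-congʳ (outside A v∉σ)) (*ₗ-zeroˡ (q v)))) zeroᶜ

    Vertices : PointSet (ℝ^ n)
    Vertices p = ∃[ v ] v Subset.∈ σ × singleton (ℝ^ n) (e v) p

    face⊆Weights : face σ ⊆ Weights σ 1#
    face⊆Weights = conv⊆ {Vertices} λ (v , v∈σ , p≈e) →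
      resp refl (λ w → sym (p≈e w)) (Weights-e v∈σ)
      where open IsConic Weights-isConic

    Weights⊆face : Weights σ 1# ⊆ face σ
    Weights⊆face {a} A = resp refl (sumᴹ-e a) (Weights⇒conic cone-face
      (λ {v} v∈σ → conv-extensive (ℝ^ n) {Vertices} (v , v∈σ , λ _ → refl)) A)
      where
      cone-face : IsConic (ℝ^ n) (cone (ℝ^ n) Vertices)
      cone-face = cone-isConic (ℝ^ n) {Vertices}
      open IsConic cone-face

  -- The slack `r` is the total of the coordinates other than `v`. If it vanishes, so does each of
  -- them, by nonnegativity, and `a` is the vertex `e v`.
  Weights-slack : ∀ {n} {σ : Subset n} (v : Fin n) {a} → Weights σ 1# a →
                  ∃[ r ] 0# ≤ r × a v + r ≈ 1# × (r ≈ 0# → ∀ w → a w ≈ e v w)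
  Weights-slack {ℕ.suc n} v {a} A = sum rest , 0≤sum 0≤rest , aᵥ+r≈1 , a≈e
    where
    rest : Vector Carrier n
    rest = removeAt a v
    0≤rest : ∀ j → 0# ≤ rest j
    0≤rest j = 0≤ A (punchIn v j)
    aᵥ+r≈1 : a v + sum rest ≈ 1#
    aᵥ+r≈1 = trans (sym (sum-remove {i = v} a)) (total A)
    a≈e : sum rest ≈ 0# → ∀ w → a w ≈ e v w
    a≈e r≈0 w with v ≟ w
    ... | yes ≡.refl = trans (sym (+-identityʳ (a v))) (trans (+-congˡ (sym r≈0)) aᵥ+r≈1)
    ... | no v≢w     = ≡.subst (λ u → a u ≈ 0#) (punchIn-punchOut v≢w)
      (sum≈0⇒≈0 0≤rest r≈0 (punchOut v≢w))

  Weights-mono : ∀ {n} {σ τ : Subset n} {t a} → σ Subset.⊆ τ → Weights σ t a → Weights τ t a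
  Weights-mono σ⊆τ A = record
    { 0≤      = 0≤ A
    ; outside = λ v∉τ → outside A (v∉τ ∘ σ⊆τ)
    ; total   = total A
    }

  -- Both hypotheses concern the same coordinates `a`, so only the vanishing condition has to be
  -- combined.
  Weights-∩ : ∀ {n} {σ τ : Subset n} {t a} →
              Weights σ t a → Weights τ t a → Weights (σ Subset.∩ τ) t a
  Weights-∩ {σ = σ} {τ} A B = record
    { 0≤      = 0≤ A
    ; outside = sup
    ; total   = total A
    }
    where
    sup : ∀ {v} → v Subset.∉ σ Subset.∩ τ → _ ≈ 0#
    sup {v} v∉ with v ∈? σ
    ... | yes v∈σ = outside B (λ v∈τ → v∉ (x∈p∩q⁺ (v∈σ , v∈τ)))
    ... | no v∉σ  = outside A v∉σ

  -- Join cells and product cells in coordinates.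

  module _ {g h : ℕ} where
    private
      module Vs = LeftModule (ℝ^ h)
      module Xs = LeftModule (ℝ^ h ^ g)
      module Ys = LeftModule (ℝ^ g)
      module C = LeftModule (Cayley g h)
      module B = LeftModule (Base g h)

    -- The coordinate `y i` records how much of the total `t` falls on the `i`-th factor of the
    -- join.
    JoinWeights : Labelling g h → Carrier → PointSet (Cayley g h)
    JoinWeights σ t (X , y) = (∀ i → Weights (σ i) (y i) (X i)) × sum y ≈ t

    ProductWeights : .{{_ : NonZero g}} → Labelling g h → PointSet (ℝ^ h ^ g)
    ProductWeights σ X = ∀ i → Weights (σ i) (1/ g) (X i)

    joinVertex : Fin g → Fin h → Point (Cayley g h)
    joinVertex i v = μ (ℝ^ h) i (e v) , e i

    JoinWeights-isConic : ∀ {σ} → IsConic (Cayley g h) (JoinWeights σ)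
    JoinWeights-isConic = record
      { resp  = λ s≈t (X≈X′ , y≈y′) (A , Σy) →
          (λ i → W.resp (y≈y′ i) (X≈X′ i) (A i)) ,
          trans (sum-cong-≋ (λ i → sym (y≈y′ i))) (trans Σy s≈t)
      ; zeroᶜ = (λ _ → W.zeroᶜ) , sum-replicate-zero g
      ; add   = λ {_} {_} {(_ , y)} {(_ , y′)} (A , Σy) (A′ , Σy′) →
          (λ i → W.add (A i) (A′ i)) , trans (∑-distrib-+ y y′) (+-cong Σy Σy′)
      ; scale = λ {c} {_} {(_ , y)} 0≤c (A , Σy) →
          (λ i → W.scale 0≤c (A i)) , trans (sym (*-distribˡ-sum c y)) (*-congˡ Σy)
      }
      where module W {n} {σ : Subset n} = IsConic (Weights-isConic {σ = σ})

    μ-JoinWeights : ∀ {σ : Labelling g h} {i a} →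
                    Weights (σ i) 1# a → JoinWeights σ 1# (μ (ℝ^ h) i a , e i)
    μ-JoinWeights {σ} {i} {a} A = block , sum-μ line i 1#
      where
      block : ∀ j → Weights (σ j) (e i j) (μ (ℝ^ h) i a j)
      block j with i ≟ j
      ... | yes ≡.refl = A
      ... | no _       = IsConic.zeroᶜ Weights-isConic

    Generators : Labelling g h → PointSet (Cayley g h)
    Generators σ = ⋃ (Fin g) λ i →
      image (ℝ^ h) (ℝ^ h ^ g) (μ (ℝ^ h) i) (face (σ i)) ⟨×⟩ singleton (ℝ^ g) (e i)

    joinCell⊆JoinWeights : ∀ {σ} → joinCell g h σ ⊆ JoinWeights σ 1#
    joinCell⊆JoinWeights {σ} = conv⊆ {Generators σ} λ { (i , (a , a∈σᵢ , X≈μa) , y≈e) →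
      resp refl (Xs.≈ᴹ-sym X≈μa , Ys.≈ᴹ-sym y≈e) (μ-JoinWeights (face⊆Weights a∈σᵢ)) }
      where open IsConic (JoinWeights-isConic {σ})

    sumᴹ-joinVertex : ∀ i (a : Vector Carrier h) →
      sumᴹ (Cayley g h) (λ v → a v C.*ₗ joinVertex i v) C.≈ᴹ (μ (ℝ^ h) i a , sum a Ys.*ₗ e i)
    sumᴹ-joinVertex i a =
      Xs.≈ᴹ-trans (sum-homo (Cayley g h) (ℝ^ h ^ g) (proj₁-linear (ℝ^ h ^ g) (ℝ^ g)) terms)
        (Xs.≈ᴹ-trans (sumᴹ-cong (ℝ^ h ^ g) (λ v → Xs.≈ᴹ-sym (μᵢ.*ₗ-homo (a v) (e v))))
        (Xs.≈ᴹ-trans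
          (Xs.≈ᴹ-sym (sum-homo (ℝ^ h) (ℝ^ h ^ g) (μ-linear (ℝ^ h) i) (λ v → a v Vs.*ₗ e v)))
          (μᵢ.⟦⟧-cong (sumᴹ-e a)))) ,
      Ys.≈ᴹ-trans (sum-homo (Cayley g h) (ℝ^ g) (proj₂-linear (ℝ^ h ^ g) (ℝ^ g)) terms)
        (Ys.≈ᴹ-sym (sum-homo line (ℝ^ g) (*ₗ-linear (ℝ^ g) (e i)) a))
      where
      module μᵢ = Linear {ℝ^ h} {ℝ^ h ^ g} (μ-linear (ℝ^ h) i)
      terms : Vector (Point (Cayley g h)) h
      terms v = a v C.*ₗ joinVertex i v

    -- A point of the cell is the sum of its blocks, and block `i` is a combination of join vertices
    -- at scale `y i`. Blocks are never normalized, so `y i` may vanish.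
    JoinWeights⇒conic : ∀ {σ T} → IsConic (Cayley g h) T →
                        (∀ i {v} → v Subset.∈ σ i → T 1# (joinVertex i v)) →
                        JoinWeights σ 1# ⊆ T 1#
    JoinWeights⇒conic {σ} {T} T-conic Tjv {X , y} (A , Σy) = resp Σy
      ( Xs.≈ᴹ-trans (sum-homo (Cayley g h) (ℝ^ h ^ g) (proj₁-linear (ℝ^ h ^ g) (ℝ^ g)) blocks)
          (sumᴹ-μ (ℝ^ h) X)
      , Ys.≈ᴹ-trans (sum-homo (Cayley g h) (ℝ^ g) (proj₂-linear (ℝ^ h ^ g) (ℝ^ g)) blocks)
          (sumᴹ-e y))
      (sumᶜ block∈T)
      where
      open IsConic T-conic
      blocks : Vector (Point (Cayley g h)) g
      blocks i = μ (ℝ^ h) i (X i) , y i Ys.*ₗ e i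
      block∈T : ∀ i → T (y i) (blocks i)
      block∈T i = resp refl
        (C.≈ᴹ-trans (sumᴹ-joinVertex i (X i)) (Xs.≈ᴹ-refl , Ys.*ₗ-congʳ (total (A i))))
        (Weights⇒conic T-conic (Tjv i) (A i))

    joinVertex∈joinCell : ∀ {σ : Labelling g h} i {v} →
                          v Subset.∈ σ i → joinVertex i v ∈ joinCell g h σ
    joinVertex∈joinCell {σ} i {v} v∈σᵢ = conv-extensive (Cayley g h) {Generators σ}
      (i , (e v , Weights⊆face (Weights-e v∈σᵢ) , Xs.≈ᴹ-refl) , Ys.≈ᴹ-refl)

    JoinWeights⊆joinCell : ∀ {σ} → JoinWeights σ 1# ⊆ joinCell g h σ
    JoinWeights⊆joinCell {σ} = JoinWeights⇒conic {T = cone (Cayley g h) (Generators σ)}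
      (cone-isConic (Cayley g h) {Generators σ}) (joinVertex∈joinCell {σ})

    module _ .{{_ : NonZero g}} where

      -- Block `i` of the Minkowski sum is exactly its `i`-th summand, a point of `face (σ i)`; the
      -- factor `1/ g` then scales its total.
      productCell⊆ProductWeights : ∀ {σ} → productCell g h σ ⊆ ProductWeights σ
      productCell⊆ProductWeights {σ} {X} (Z , (p , p∈ , Z≈) , X≈) i =
        resp (*-identityʳ (1/ g))
          (λ v → trans (*-congˡ (sym (Z≈a i v))) (sym (X≈ i v)))
          (scale (0≤1/n g) (face⊆Weights (proj₁ (proj₂ (p∈ i)))))
        where
        open IsConic Weights-isConic
        a : Point (ℝ^ h ^ g)
        a i = proj₁ (p∈ i)
        Z≈a : Z Xs.≈ᴹ a
        Z≈a = Xs.≈ᴹ-trans Z≈ (Xs.≈ᴹ-trans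
          (sumᴹ-cong (ℝ^ h ^ g) (λ j → proj₂ (proj₂ (p∈ j)))) (sumᴹ-μ (ℝ^ h) a))

      ProductWeights⊆productCell : ∀ {σ} → ProductWeights σ ⊆ productCell g h σ
      ProductWeights⊆productCell {σ} {X} A =
        Z ,
        ( (λ i → μ (ℝ^ h) i (Z i))
        , (λ i → Z i , Weights⊆face (Z∈ i) , Xs.≈ᴹ-refl)
        , Xs.≈ᴹ-sym (sumᴹ-μ (ℝ^ h) Z)) ,
        λ i v → sym (trans (sym (*-assoc _ _ _))
          (trans (*-congʳ (trans (*-comm _ _) (n·1*1/n≈1 g))) (*-identityˡ (X i v))))
        where
        -- Multiplying by `g · 1#` undoes the factor `1/ g` of the product cell and restores total
        -- `1#` in each block.
        Z : Point (ℝ^ h ^ g)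
        Z i v = (g · 1#) * X i v
        Z∈ : ∀ i → Weights (σ i) 1# (Z i)
        Z∈ i = resp (n·1*1/n≈1 g) (λ _ → refl) (scale (0≤n·1 g) (A i))
          where open IsConic Weights-isConic

      joinCell∩L⊆product : ∀ {σ : Labelling g h} →
        joinCell g h σ ∩ L g h ⊆ (productCell g h σ ⟨×⟩ singleton (ℝ^ g) (𝟏/g g h))
      joinCell∩L⊆product {σ} (p∈σ , y≈) =
        ProductWeights⊆productCell (λ i → IsConic.resp Weights-isConic (y≈ i) (λ _ → refl)
          (proj₁ (joinCell⊆JoinWeights {σ} p∈σ) i)) , y≈

      product⊆joinCell∩L : ∀ {σ : Labelling g h} →
        (productCell g h σ ⟨×⟩ singleton (ℝ^ g) (𝟏/g g h)) ⊆ joinCell g h σ ∩ L g h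
      product⊆joinCell∩L {σ} (X∈σ , y≈) =
        JoinWeights⊆joinCell {σ}
          ( (λ i → IsConic.resp Weights-isConic (sym (y≈ i)) (λ _ → refl)
              (productCell⊆ProductWeights {σ} X∈σ i))
          -- On `L` the total over all blocks is the sum of `g` copies of `1/ g`.
          , trans (sum-cong-≋ y≈) (sum-1/n g)) , y≈

      joinCell∩L⇒transversal : ∀ {σ} → Satisfiable (joinCell g h σ ∩ L g h) → Transversal σ
      joinCell∩L⇒transversal {σ} (_ , p∈σ , y≈) i =
        Weights-nonempty (λ y≈0 → 1/n≉0 g (trans (sym (y≈ i)) y≈0))
          (proj₁ (joinCell⊆JoinWeights {σ} p∈σ) i)

      -- A vertex chosen in every block yields a point of the cell; such points show cells nonempty
      -- and detect which vertices belong to the labels.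
      productVertex : (Fin g → Fin h) → Point (ℝ^ h ^ g)
      productVertex c i = 1/ g Vs.*ₗ e (c i)

      productVertex∈productCell : ∀ {σ : Labelling g h} {c} → (∀ i → c i Subset.∈ σ i) →
                                  productVertex c ∈ productCell g h σ
      productVertex∈productCell c∈σ = ProductWeights⊆productCell λ i →
        IsConic.scale₁ Weights-isConic (0≤1/n g) (Weights-e (c∈σ i))

      transversal⇒joinCell∩L : ∀ {σ} → Transversal σ → Satisfiable (joinCell g h σ ∩ L g h)
      transversal⇒joinCell∩L {σ} σ-transversal =
        (productVertex (proj₁ ∘ σ-transversal) , 𝟏/g g h) ,
        product⊆joinCell∩L {σ} (productVertex∈productCell {σ} (proj₂ ∘ σ-transversal) , λ _ → refl)

    -- Cells fit together as geometric complexes.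

    joinCell-mono : ∀ {σ τ : Labelling g h} → σ ⊑ τ → joinCell g h σ ⊆ joinCell g h τ
    joinCell-mono {σ} {τ} σ⊑τ p∈σ with joinCell⊆JoinWeights {σ} p∈σ
    ... | A , Σy = JoinWeights⊆joinCell {τ} ((λ i → Weights-mono (σ⊑τ i) (A i)) , Σy)

    -- Stated for any family closed under passing to faces, so that it covers `Hom₊Face` and
    -- `Hom₊ᵗFace` alike.
    joinCell-isEmbedded : ∀ {C : Pred (Labelling g h) 0ℓ} →
                          (∀ {σ τ} → σ ∈ C → τ ⊑ σ → τ ∈ C) →
                          IsEmbedded (Cayley g h) (joinCell g h) C
    joinCell-isEmbedded {C} C-down = record
      { order-embedding = λ {σ} {τ} _ _ → mk⇔ (⊆⇒⊑ {σ} {τ}) (joinCell-mono {σ} {τ})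
      ; meet            = λ {σ} {τ} _ _ →
          (λ (p∈σ , p∈τ) →
            ∩⊆⊓ {σ} {τ} (joinCell⊆JoinWeights {σ} p∈σ) (joinCell⊆JoinWeights {τ} p∈τ)) ,
          (λ p∈ → joinCell-mono {σ ⊓ τ} {σ} (λ i → p∩q⊆p (σ i) (τ i)) p∈ ,
                  joinCell-mono {σ ⊓ τ} {τ} (λ i → p∩q⊆q (σ i) (τ i)) p∈)
      ; meet-cell       = λ {σ} {τ} σ∈C _ _ → C-down σ∈C (λ i → p∩q⊆p (σ i) (τ i))
      }
      where
      -- The join vertex of `v` in block `i` has coordinate `1#` there, and a nonzero coordinate
      -- forces `v` into `τ i`.
      ⊆⇒⊑ : ∀ {σ τ} → joinCell g h σ ⊆ joinCell g h τ → σ ⊑ τ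
      ⊆⇒⊑ {σ} {τ} σ⊆τ i {v} v∈σᵢ = Weights-∈ 1≉0
        (trans (μ-diag (ℝ^ h) i (e v) v) (μ-diag line v 1#))
        (proj₁ (joinCell⊆JoinWeights {τ} (σ⊆τ (joinVertex∈joinCell {σ} i v∈σᵢ))) i)
      ∩⊆⊓ : ∀ {σ τ p} → JoinWeights σ 1# p → JoinWeights τ 1# p → joinCell g h (σ ⊓ τ) p
      ∩⊆⊓ {σ} {τ} (A , Σy) (A′ , _) =
        JoinWeights⊆joinCell {σ ⊓ τ} ((λ i → Weights-∩ (A i) (A′ i)) , Σy)

    module _ .{{_ : NonZero g}} where

      private
        cell : Labelling g h → PointSet (Cayley g h)
        cell σ = productCell g h σ ⟨×⟩ singleton (ℝ^ g) (𝟏/g g h)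

      productCell-mono : ∀ {σ τ : Labelling g h} → σ ⊑ τ → productCell g h σ ⊆ productCell g h τ
      productCell-mono {σ} {τ} σ⊑τ X∈σ =
        ProductWeights⊆productCell λ i →
          Weights-mono (σ⊑τ i) (productCell⊆ProductWeights {σ} X∈σ i)

      -- Closure is asked only for transversal labellings, since a product with an empty factor is
      -- not a cell. A common point of two cells makes their meet transversal: each of its blocks
      -- has the nonzero total `1/ g`.
      productCell-isEmbedded : ∀ {C : Pred (Labelling g h) 0ℓ} → C ⊆ Transversal →
                               (∀ {σ τ} → σ ∈ C → τ ⊑ σ → Transversal τ → τ ∈ C) →
                               IsEmbedded (Cayley g h) cell C
      productCell-isEmbedded {C} C-transversal C-down = record
        { order-embedding = λ {σ} {τ} σ∈C _ → mk⇔ (⊆⇒⊑ {σ} {τ} (C-transversal σ∈C))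
            (λ σ⊑τ (X∈σ , y≈) → productCell-mono {σ} {τ} σ⊑τ X∈σ , y≈)
        ; meet            = λ {σ} {τ} _ _ →
            (λ ((X∈σ , y≈) , (X∈τ , _)) →
              ProductWeights⊆productCell (∩⊆⊓ {σ} {τ} X∈σ X∈τ) , y≈) ,
            (λ (X∈ , y≈) → (productCell-mono {σ ⊓ τ} {σ} (λ i → p∩q⊆p (σ i) (τ i)) X∈ , y≈) ,
                           (productCell-mono {σ ⊓ τ} {τ} (λ i → p∩q⊆q (σ i) (τ i)) X∈ , y≈))
        ; meet-cell       = λ {σ} {τ} σ∈C _ (_ , (X∈σ , _) , (X∈τ , _)) →
            C-down σ∈C (λ i → p∩q⊆p (σ i) (τ i))
              (λ i → Weights-nonempty (1/n≉0 g) (∩⊆⊓ {σ} {τ} X∈σ X∈τ i))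
        }
        where
        ∩⊆⊓ : ∀ {σ τ X} → X ∈ productCell g h σ → X ∈ productCell g h τ → ProductWeights (σ ⊓ τ) X
        ∩⊆⊓ {σ} {τ} X∈σ X∈τ i = Weights-∩
          (productCell⊆ProductWeights {σ} X∈σ i) (productCell⊆ProductWeights {τ} X∈τ i)
        -- A product vertex needs an entry in every block, so a prescribed `v` in block `i` is
        -- completed using transversality.
        choose : ∀ {σ} → Transversal σ → ∀ i {v} → v Subset.∈ σ i →
                 ∃[ c ] (∀ j → c j Subset.∈ σ j) × c i ≡ v
        choose {σ} σ-transversal i {v} v∈σᵢ =
          proj₁ ∘ pick , proj₁ ∘ proj₂ ∘ pick , proj₂ (proj₂ (pick i)) ≡.refl
          where
          pick : ∀ j → ∃[ u ] u Subset.∈ σ j × (i ≡ j → u ≡ v)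
          pick j with i ≟ j
          ... | yes ≡.refl = v , v∈σᵢ , λ _ → ≡.refl
          ... | no i≢j     = map id (_, λ i≡j → contradiction i≡j i≢j) (σ-transversal j)
        ⊆⇒⊑ : ∀ {σ τ} → Transversal σ → cell σ ⊆ cell τ → σ ⊑ τ
        ⊆⇒⊑ {σ} {τ} σ-transversal σ⊆τ i v∈σᵢ with choose σ-transversal i v∈σᵢ
        -- The product vertex of `c` has the nonzero coordinate `1/ g` at `c i` in block `i`, which
        -- puts `c i` in `τ i`.
        ... | c , c∈σ , ≡.refl = Weights-∈ (1/n≉0 g)
          (trans (*-congˡ (μ-diag line (c i) 1#)) (*-identityʳ (1/ g)))
          (productCell⊆ProductWeights {τ} (proj₁ (σ⊆τ {productVertex c , 𝟏/g g h}
            (productVertex∈productCell {σ} c∈σ , λ _ → refl))) i)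

    -- Projections of join cells and vertices of the product of simplices.

    baseVertex : Fin g → Fin h → Point (Base g h)
    baseVertex i v = e v , e i

    π□-joinVertex : ∀ i v → π□ g h (joinVertex i v) B.≈ᴹ baseVertex i v
    π□-joinVertex i v = sum-μ (ℝ^ h) i (e v) , Ys.≈ᴹ-refl

    BaseVertices : Labelling g h → PointSet (Base g h)
    BaseVertices σ z = ∃[ i ] ∃[ v ] v Subset.∈ σ i × z B.≈ᴹ baseVertex i v

    -- A linear map carries a hull to the hull of the images. One inclusion checks the pullback of
    -- the target cone at the join vertices, the other checks the image of the source cone at the
    -- base vertices.
    π-joinCell≐conv : ∀ {σ} → π g h (joinCell g h σ) ≐ conv (Base g h) (BaseVertices σ)
    π-joinCell≐conv {σ} =
      (λ { (p , p∈σ , z≈) → IsConic.resp cone-base refl (B.≈ᴹ-sym z≈)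
        (JoinWeights⇒conic {T = λ t x → cone (Base g h) (BaseVertices σ) t (π□ g h x)}
          (preimage-isConic (Cayley g h) (Base g h) (π□-linear g h) cone-base)
          (λ i {v} v∈σᵢ →
            conv-extensive (Base g h) {BaseVertices σ} (i , v , v∈σᵢ , π□-joinVertex i v))
          (joinCell⊆JoinWeights {σ} p∈σ)) }) ,
      IsConic.conv⊆
        (image-isConic (Cayley g h) (Base g h) (π□-linear g h)
          (cone-isConic (Cayley g h) {Generators σ}))
        {BaseVertices σ}
        (λ { (i , v , v∈σᵢ , z≈) →
          joinVertex i v , joinVertex∈joinCell {σ} i v∈σᵢ ,
          B.≈ᴹ-trans z≈ (B.≈ᴹ-sym (π□-joinVertex i v)) })
      where
      cone-base : IsConic (Base g h) (cone (Base g h) (BaseVertices σ))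
      cone-base = cone-isConic (Base g h) {BaseVertices σ}

    baseVertex-isVertex : ∀ i v {z} → z B.≈ᴹ baseVertex i v → IsVertex (Base g h) (Δ h ⟨×⟩ Δ g) z
    baseVertex-isVertex i v {z} z≈ =
      (in-Δ v (proj₁ z≈) , in-Δ i (proj₂ z≈)) , φ , φ-linear , maximal
      where
      in-Δ : ∀ {n} (w : Fin n) {a : Vector Carrier n} → (∀ k → a k ≈ e w k) → a ∈ Δ n
      in-Δ w a≈e = Weights⊆face
        (IsConic.resp Weights-isConic refl (λ k → sym (a≈e k)) (Weights-e {v = w} ∈⊤))
      φ : Point (Base g h) → Carrier
      φ (x , y) = x v + y i
      φ-linear : Linear (Base g h) line φ
      φ-linear = linear (Base g h) line
        (λ (x≈ , y≈) → +-cong (x≈ v) (y≈ i))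
        (λ (x , y) (x′ , y′) → +-interchange (x v) (x′ v) (y i) (y′ i))
        (λ c (x , y) → sym (distribˡ c (x v) (y i)))
      φz≈2 : φ z ≈ 1# + 1#
      φz≈2 = +-cong (trans (proj₁ z≈ v) (μ-diag line v 1#)) (trans (proj₂ z≈ i) (μ-diag line i 1#))
      maximal : ∀ {q} → q ∈ (Δ h ⟨×⟩ Δ g) → φ q ≤ φ z × (φ q ≈ φ z → q B.≈ᴹ z)
      maximal {x , y} (x∈Δ , y∈Δ)
        with Weights-slack v (face⊆Weights x∈Δ) | Weights-slack i (face⊆Weights y∈Δ)
      ... | r , 0≤r , xᵥ+r≈1 , r≈0⇒ | s , 0≤s , yᵢ+s≈1 , s≈0⇒ =
        x+z≈y⇒x≤y (0≤x+y 0≤r 0≤s) slack ,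
        -- Equality of the two values leaves no total slack `r + s`; both slacks are nonnegative, so
        -- each vanishes and `q` is the vertex.
        λ φq≈φz → let r+s≈0 = +-identityʳ-unique _ _ (trans slack (sym φq≈φz)) in
          B.≈ᴹ-trans
            ( r≈0⇒ (x+y≈0⇒x≈0 0≤r 0≤s r+s≈0)
            , s≈0⇒ (x+y≈0⇒x≈0 0≤s 0≤r (trans (+-comm s r) r+s≈0)))
            (B.≈ᴹ-sym z≈)
        where
        slack : x v + y i + (r + s) ≈ φ z
        slack = trans (+-interchange (x v) (y i) r s) (trans (+-cong xᵥ+r≈1 yᵢ+s≈1) (sym φz≈2))

    π-joinCell⊆Δ×Δ : ∀ {σ} → π g h (joinCell g h σ) ⊆ (Δ h ⟨×⟩ Δ g)
    π-joinCell⊆Δ×Δ {σ} {z₁ , z₂} ((X , y) , p∈σ , z₁≈ , z₂≈) with joinCell⊆JoinWeights {σ} p∈σ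
    ... | A , Σy =
      -- Adding the blocks adds their totals `y i`, which sum to `1#`.
      Weights⊆face (resp Σy (λ v → sym (z₁≈ v)) (sumᶜ (λ i → Weights-mono (λ _ → ∈⊤) (A i)))) ,
      Weights⊆face (resp refl (λ i → sym (z₂≈ i)) record
        { 0≤      = λ i → 0≤total (A i)
        ; outside = λ i∉⊤ → contradiction ∈⊤ i∉⊤
        ; total   = Σy
        })
      where open module W {n} {σ : Subset n} = IsConic (Weights-isConic {σ = σ}) using (resp; sumᶜ)

    -- The first component of every join vertex is a vertex of the simplex on all pairs, and taking
    -- that component is linear.
    joinCell⊆Δ× : ∀ {σ p} → p ∈ joinCell g h σ → proj₁ p ∈ Δ× g h
    joinCell⊆Δ× {σ} p∈σ = JoinWeights⇒conic {T = λ t x → cone (ℝ^ h ^ g) Vertices× t (proj₁ x)}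
      (preimage-isConic (Cayley g h) (ℝ^ h ^ g) (proj₁-linear (ℝ^ h ^ g) (ℝ^ g))
        (cone-isConic (ℝ^ h ^ g) {Vertices×}))
      (λ i {v} _ → conv-extensive (ℝ^ h ^ g) {Vertices×} (i , v , Xs.≈ᴹ-refl))
      (joinCell⊆JoinWeights {σ} p∈σ)
      where
      Vertices× : PointSet (ℝ^ h ^ g)
      Vertices× p = ∃[ x ] ∃[ v ] singleton (ℝ^ h ^ g) (μ (ℝ^ h) x (e v)) p

  -- The Hom complexes and the commuting square.

  image-mono : ∀ V W {f : Point V → Point W} {P Q : PointSet V} →
               P ⊆ Q → image V W f P ⊆ image V W f Q
  image-mono V W P⊆Q (x , x∈P , y≈) = x , P⊆Q x∈P , y≈

  module _ {g h : ℕ} .{{_ : NonZero g}} (G : Graph g) (H : Graph h) where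
    private
      module B = LeftModule (Base g h)

    Hom₊Face-down : ∀ {σ τ} → Hom₊Face G H σ → τ ⊑ σ → Hom₊Face G H τ
    Hom₊Face-down σ∈ τ⊑σ xy (u , u∈) (v , v∈) u′∈ v′∈ =
      σ∈ xy (u , τ⊑σ _ u∈) (v , τ⊑σ _ v∈) (τ⊑σ _ u′∈) (τ⊑σ _ v′∈)

    Hom₊ᵗFace-down : ∀ {σ τ} → Hom₊ᵗFace G H σ → τ ⊑ σ → Hom₊ᵗFace G H τ
    Hom₊ᵗFace-down (ρ , ρ∈ , ρ-transversal , σ⊑ρ) τ⊑σ =
      ρ , ρ∈ , ρ-transversal , λ x u∈ → σ⊑ρ x (τ⊑σ x u∈)

    HomCell-down : ∀ {σ τ} → HomCell G H σ → τ ⊑ σ → Transversal τ → HomCell G H τ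
    HomCell-down (_ , σ∈) τ⊑σ τ-transversal =
      τ-transversal , λ xy u∈ v∈ → σ∈ xy (τ⊑σ _ u∈) (τ⊑σ _ v∈)

    Hom₊ᵗFace⊆Hom₊Face : Hom₊ᵗFace G H ⊆ Hom₊Face G H
    Hom₊ᵗFace⊆Hom₊Face (ρ , ρ∈ , _ , σ⊑ρ) = Hom₊Face-down ρ∈ σ⊑ρ

    transversal⇒Hom₊ᵗFace : ∀ {σ} → Hom₊Face G H σ → Transversal σ → Hom₊ᵗFace G H σ
    transversal⇒Hom₊ᵗFace {σ} σ∈ σ-transversal = σ , σ∈ , σ-transversal , λ _ → id

    Hom₊Face⇒HomCell : ∀ {σ} → Hom₊Face G H σ → Transversal σ → HomCell G H σ
    Hom₊Face⇒HomCell σ∈ σ-transversal =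
      σ-transversal , λ xy → σ∈ xy (σ-transversal _) (σ-transversal _)

    HomCell⇒Hom₊Face : ∀ {σ} → HomCell G H σ → Hom₊Face G H σ
    HomCell⇒Hom₊Face (_ , σ∈) xy _ _ = σ∈ xy

    -- Hom₊ and Hom₊ᵗ are the largest and the smallest possible C.
    module _ {C : Pred (Labelling g h) 0ℓ}
             (C⊆Hom₊ : C ⊆ Hom₊Face G H)
             (transversal⇒C : ∀ {σ} → Hom₊Face G H σ → Transversal σ → σ ∈ C) where

      private
        𝓚 : Family (Cayley g h) ℓ
        𝓚 = realise (Cayley g h) (joinCell g h) C

      -- A point of the section witnesses that `σ` is transversal, and for transversal labellings
      -- the conditions of `Hom₊Face` and `HomCell` agree.
      section∈Hom : ∀ {P} → P ∈ 𝓚 → Satisfiable (P ∩ L g h) → P ∩ L g h ∈ Hom×𝟏/g G H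
      section∈Hom (σ , σ∈C , P⊆σ , σ⊆P) (x , x∈P , x∈L) =
        productCell g h σ ,
        ( σ
        , Hom₊Face⇒HomCell (C⊆Hom₊ σ∈C) (joinCell∩L⇒transversal {σ = σ} (x , P⊆σ x∈P , x∈L))
        , id , id) ,
        (λ (p∈P , p∈L) → joinCell∩L⊆product {σ = σ} (P⊆σ p∈P , p∈L)) ,
        (λ p∈ → let p∈σ , p∈L = product⊆joinCell∩L {σ = σ} p∈ in σ⊆P p∈σ , p∈L)

      -- A cell of `Hom` has a transversal labelling, which therefore lies in `C`, and its join cell
      -- meets `L`.
      Hom⇒section : ∀ {P} → P ∈ Hom×𝟏/g G H →
                    Σ[ σ ∈ Labelling g h ] σ ∈ C × P ≐ joinCell g h σ ∩ L g h × Satisfiable P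
      Hom⇒section {P} (Q , (σ , σ∈ , Q⊆σ , σ⊆Q) , P⊆Q , Q⊆P) =
        σ , transversal⇒C (HomCell⇒Hom₊Face σ∈) (proj₁ σ∈) ,
        (to , from) ,
        map id from (transversal⇒joinCell∩L {σ = σ} (proj₁ σ∈))
        where
        to : P ⊆ joinCell g h σ ∩ L g h
        to p∈P = let X∈Q , y≈ = P⊆Q p∈P in product⊆joinCell∩L {σ = σ} (Q⊆σ X∈Q , y≈)
        from : joinCell g h σ ∩ L g h ⊆ P
        from p∈ = let X∈σ , y≈ = joinCell∩L⊆product {σ = σ} p∈ in Q⊆P (σ⊆Q X∈σ , y≈)

      π-∩-L : ∀ {P} → π g h (P ∩ L g h) ≐ π g h P ∩ π g h (L g h)
      π-∩-L =
        (λ (p , (p∈P , p∈L) , z≈) → (p , p∈P , z≈) , (p , p∈L , z≈)) ,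
        -- The point of `L` over `z` has the same `y` as `p`, so `p` itself lies in `L`.
        (λ ((p , p∈P , z₁≈ , z₂≈) , (_ , q∈L , _ , z₂≈′)) →
          p , (p∈P , λ i → trans (sym (z₂≈ i)) (trans (z₂≈′ i) (q∈L i))) , z₁≈ , z₂≈)

      π-reflects-satisfiable : ∀ {P} →
        Satisfiable (π g h P ∩ π g h (L g h)) → Satisfiable (P ∩ L g h)
      π-reflects-satisfiable (z , z∈) = let p , p∈ , _ = proj₂ π-∩-L z∈ in p , p∈

      ι-L≐Hom : ι (Cayley g h) (L g h) 𝓚 ≐ Hom×𝟏/g G H
      ι-L≐Hom =
        (λ (Q , Q∈𝓚 , (P⊆ , ⊆P) , x , x∈P) →
          let R , R∈Hom , ⊆R , R⊆ = section∈Hom Q∈𝓚 (x , P⊆ x∈P) in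
          R , R∈Hom , ⊆R ∘ P⊆ , ⊆P ∘ R⊆) ,
        (λ P∈ → let σ , σ∈C , P≐ , P-sat = Hom⇒section P∈ in
          joinCell g h σ , (σ , σ∈C , id , id) , P≐ , P-sat)

      square : Square G H 𝓚
      square = record
        { top-defined      = section∈Hom
        ; bottom-defined   = λ { {Q} (P , P∈𝓚 , Q⊆ , ⊆Q) (z , z∈Q , z∈L) →
            P ∩ L g h ,
            section∈Hom P∈𝓚 (π-reflects-satisfiable (z , Q⊆ z∈Q , z∈L)) ,
            proj₂ π-∩-L ∘ map Q⊆ id ,
            map ⊆Q id ∘ proj₁ π-∩-L }
        ; discards         = λ _ → mk⇔
            (λ (p , p∈) → π□ g h p , proj₁ π-∩-L (p , p∈ , B.≈ᴹ-refl))
            π-reflects-satisfiable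
        ; commutes         = λ _ → π-∩-L
        ; 𝓚-faces          = λ (σ , _ , P≐σ) → σ , _ , P≐σ
        ; 𝓚-support        = λ (P , (σ , _ , P⊆σ , _) , p∈P) →
            joinCell-mono {σ = σ} (λ _ _ → ∈⊤) (P⊆σ p∈P)
        ; Hom-support      = λ (P , P∈ , p∈P) →
            let σ , _ , (P⊆ , _) , _ = Hom⇒section P∈ ; p∈σ , p∈L = P⊆ p∈P in
            joinCell⊆Δ× {σ = σ} p∈σ , p∈L
        ; π𝓚-support       = λ (Q , (P , (σ , _ , P⊆σ , _) , Q⊆ , _) , z∈Q) →
            π-joinCell⊆Δ×Δ {σ = σ} (image-mono (Cayley g h) (Base g h) P⊆σ (Q⊆ z∈Q))
        ; πHom-support     = λ (Q , (P , P∈ , Q⊆ , _) , z∈Q) →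
            let σ , _ , (P⊆ , _) , _ = Hom⇒section P∈
                p , p∈P , z≈         = Q⊆ z∈Q
                p∈σ , p∈L            = P⊆ p∈P
            in proj₁ (π-joinCell⊆Δ×Δ {σ = σ} (p , p∈σ , z≈)) ,
               λ i → trans (proj₂ z≈ i) (p∈L i)
        ; hull-of-vertices = λ (σ , _ , P⊆σ , σ⊆P) →
            BaseVertices σ ,
            (λ (i , v , _ , z≈) → baseVertex-isVertex i v z≈) ,
            proj₁ (π-joinCell≐conv {σ = σ}) ∘ image-mono (Cayley g h) (Base g h) P⊆σ ,
            image-mono (Cayley g h) (Base g h) σ⊆P ∘ proj₂ (π-joinCell≐conv {σ = σ})
        ; sections         =
            (λ (P , P∈ , Q⊆ , ⊆Q) →
              let σ , σ∈C , (P⊆ , ⊆P) , (p , p∈P) = Hom⇒section P∈ in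
              π g h (joinCell g h σ) ,
              (joinCell g h σ , (σ , σ∈C , id , id) , id , id) ,
              ( proj₁ π-∩-L ∘ image-mono (Cayley g h) (Base g h) P⊆ ∘ Q⊆
              , ⊆Q ∘ image-mono (Cayley g h) (Base g h) ⊆P ∘ proj₂ π-∩-L ) ,
              -- Membership in `ι` demands a point, and the image of a point of the cell supplies
              -- it.
              π□ g h p , ⊆Q (p , p∈P , B.≈ᴹ-refl)) ,
            (λ (R , (P , P∈𝓚 , R⊆ , ⊆R) , (Q⊆ , ⊆Q) , z , z∈Q) →
              P ∩ L g h ,
              section∈Hom P∈𝓚 (π-reflects-satisfiable (z , map R⊆ id (Q⊆ z∈Q))) ,
              proj₂ π-∩-L ∘ map R⊆ id ∘ Q⊆ ,
              ⊆Q ∘ map ⊆R id ∘ proj₁ π-∩-L)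
        }

theorem2p7 : ∀ {ℓ} (ℝ : OrderedField ℓ) → let open Geometry ℝ in
    ∀ {g h : ℕ} .{{_ : NonZero g}} (G : Graph g) (H : Graph h) →
    ( ι (Cayley g h) (L g h) (Hom₊ᵗ G H) ≐ ι (Cayley g h) (L g h) (Hom₊ G H)
    × ι (Cayley g h) (L g h) (Hom₊ G H) ≐ Hom×𝟏/g G H
    × IsEmbedded (Cayley g h) (joinCell g h) (Hom₊Face G H)
    × IsEmbedded (Cayley g h) (joinCell g h) (Hom₊ᵗFace G H)
    × IsEmbedded (Cayley g h) (λ σ → productCell g h σ ⟨×⟩ singleton (ℝ^ g) (𝟏/g g h)) (HomCell G H))
    × Square G H (Hom₊ G H)
    × Square G H (Hom₊ᵗ G H)
theorem2p7 ℝ {g} {h} G H =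
  -- The two sections are compared through their common value `Hom×𝟏/g G H`.
  ( (proj₂ ι-Hom₊ ∘ proj₁ ι-Hom₊ᵗ , proj₂ ι-Hom₊ᵗ ∘ proj₁ ι-Hom₊)
  , ι-Hom₊
  , joinCell-isEmbedded (Hom₊Face-down G H)
  , joinCell-isEmbedded (Hom₊ᵗFace-down G H)
  , productCell-isEmbedded proj₁ (HomCell-down G H))
  , square G H id const
  -- A transversal face of `Hom₊` is a face of itself and hence lies in `Hom₊ᵗ`.
  , square G H (Hom₊ᵗFace⊆Hom₊Face G H) (transversal⇒Hom₊ᵗFace G H)
  where
  open ConvexGeometry ℝ
  ι-Hom₊  = ι-L≐Hom G H {Hom₊Face G H} id const
  ι-Hom₊ᵗ = ι-L≐Hom G H (Hom₊ᵗFace⊆Hom₊Face G H) (transversal⇒Hom₊ᵗFace G H)
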